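{- There exists a zero-error randomized query algorithm which, for every $n\ge 1$ and every tournament $T$ on $n$ vertices (accessed through edge-orientation queries), always outputs a king of $T$ and makes at most $2n$ queries in expectation, the expectation being over the algorithm's internal randomness.
   Context: A tournament is a directed graph such that for every two distinct vertices $u,v$ exactly one of the edges $u\to v$, $v\to u$ is present. A vertex $v$ of a tournament is a king if for every other vertex $u$ there is a directed path from $v$ to $u$ of length (number of edges) at most $2$. Query model: the vertex set is known to the algorithm; each query specifies a pair of distinct vertices $u,v$, and the oracle answers whether $u\to v$ or $v\to u$. Only the number of queries is counted. A randomized query algorithm is a probability distribution over deterministic decision trees (equivalently, it may use internal randomness to choose its queries); it is zero-error if its output is always correct. -}

module Defs where

open import Data.Fin.Base using (Fin)
open import Data.Integer.Base using (+_)
open import Data.Nat.Base as ℕ using (ℕ; zero; suc)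
open import Data.Product.Base using (∃; _,_)
open import Data.Rational.Base using (ℚ; 0ℚ; 1ℚ; _*_; _/_; _<_)
open import Data.Rational.Properties using (+-0-monoid)
open import Data.Sum.Base using (_⊎_; inj₁; inj₂)
open import Level using (0ℓ)
open import Relation.Binary.Core using (Rel)
open import Relation.Binary.Construct.Closure.ReflexiveTransitive using (Star; fold)
open import Relation.Binary.Definitions using (Trichotomous; tri<; tri≈; tri>)
open import Relation.Binary.PropositionalEquality.Core using (_≡_; _≢_)
open import Relation.Nullary.Negation using (contradiction)

open import Algebra.Properties.Monoid.Sum +-0-monoid using (sum-syntax)

-- Trichotomy says that exactly one of u ⟶ v, u ≡ v, v ⟶ u holds: exactly one
-- of the two possible edges between distinct vertices, and no loops.
record Tournament (n : ℕ) : Set₁ where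
  infix 4 _⟶_
  field
    _⟶_     : Rel (Fin n) 0ℓ
    compare : Trichotomous _≡_ _⟶_

module _ {n : ℕ} (T : Tournament n) where
  open Tournament T

  -- Vertices are not required to be pairwise distinct; since there are no
  -- loops, they automatically are for length ≤ 2 and distinct endpoints.
  Path : Rel (Fin n) 0ℓ
  Path = Star _⟶_

  length : ∀ {u v} → Path u v → ℕ
  length = fold (λ _ _ → ℕ) (λ _ k → suc k) zero

  King : Fin n → Set
  King v = ∀ u → u ≢ v → ∃ λ (p : Path v u) → length p ℕ.≤ 2

  oracle : ∀ u v → u ≢ v → (u ⟶ v) ⊎ (v ⟶ u)
  oracle u v u≢v with compare u v
  ... | tri< u⟶v _ _ = inj₁ u⟶v
  ... | tri≈ _ u≡v _ = contradiction u≡v u≢v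
  ... | tri> _ _ v⟶u = inj₂ v⟶u

-- In  query u v _ s t  the computation continues with s if the answer is
-- u ⟶ v, and with t if the answer is v ⟶ u.
data DecisionTree (n : ℕ) : Set where
  return : Fin n → DecisionTree n
  query  : (u v : Fin n) → u ≢ v → (s t : DecisionTree n) → DecisionTree n

module _ {n : ℕ} (T : Tournament n) where

  output : DecisionTree n → Fin n
  output (return v) = v
  output (query u v u≢v s t) with oracle T u v u≢v
  ... | inj₁ _ = output s
  ... | inj₂ _ = output t

  queries : DecisionTree n → ℕ
  queries (return _) = 0
  queries (query u v u≢v s t) with oracle T u v u≢v
  ... | inj₁ _ = suc (queries s)
  ... | inj₂ _ = suc (queries t)

-- A finitely supported probability distribution with rational weights.  The
-- trees are those of the support (possibly with repetitions), so the weights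
-- are positive.
record RandomizedAlgorithm (n : ℕ) : Set where
  field
    size     : ℕ
    tree     : Fin size → DecisionTree n
    weight   : Fin size → ℚ
    positive : ∀ i → 0ℚ < weight i
    total    : ∑[ i < size ] weight i ≡ 1ℚ

module _ {n : ℕ} (R : RandomizedAlgorithm n) (T : Tournament n) where
  open RandomizedAlgorithm R

  AlwaysOutputsKing : Set
  AlwaysOutputsKing = ∀ i → King T (output T (tree i))

  expectedQueries : ℚ
  expectedQueries = ∑[ i < size ] (weight i * (+ queries T (tree i) / 1))

{-# OPTIONS --safe #-}
-- Scan the current candidates against a uniformly random one of them, the
-- pivot, and keep only the in-neighbours of the pivot; the last pivot is a king.
-- Indeed it beats all earlier pivots, and each discarded vertex is an earlier
-- pivot or beaten by one.  A scan of m candidates costs at most m queries, and a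
-- random candidate has on average at most m / 2 in-neighbours among them, so
-- inductively at most m + 2 (m / 2) = 2 m queries are expected.
--
-- The numbers of candidates strictly decrease, so a single uniform seed in
-- Fin (n !), read as one element of Fin k for each k ≤ n, supplies the
-- independent uniform pivots of a run: the k-th component is used only if at
-- some point there are exactly k candidates.
module Submission where

open import Defs
open import Data.Bool.Base using (true; false)
open import Data.Fin.Base using (Fin; zero; suc; cast; combine; remQuot; _↑ˡ_; _↑ʳ_)
open import Data.Fin.Properties using (_≟_; remQuot-combine)
open import Data.Integer.Base using (+_)
import Data.Integer.Base as ℤ
import Data.Integer.Properties as ℤ
open import Data.List.Base as List using (List; []; _∷_; allFin; filter; lookup)
open import Data.List.Membership.Propositional using (_∈_; _∉_; lose)
open import Data.List.Membership.Propositional.Properties using (∈-filter⁺; ∈-filter⁻; ∈-lookup; ∈-allFin)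
open import Data.List.Properties using (filter-accept; filter-reject; filter-notAll; length-tabulate)
open import Data.List.Relation.Unary.Any using (here; there; any?)
open import Data.Nat.Base using (ℕ; zero; suc; NonZero; _+_; _*_; _!; z≤n; s≤s; s≤s⁻¹)
import Data.Nat.Base as ℕ
import Data.Nat.ListAction as ListAction
import Data.Nat.Properties as ℕ
open import Data.Nat.Solver using (module +-*-Solver)
open import Data.Product.Base using (Σ-syntax; ∃; _×_; _,_; proj₁; proj₂)
open import Data.Rational.Base as ℚ using (ℚ; _/_; _≤_; *≤*; 1ℚ; 1/_)
open import Data.Rational.Literals using (fromℤ)
import Data.Rational.Properties as ℚ
open import Data.Sum.Base using (inj₁; inj₂)
open import Function.Base using (_∘_)
open import Relation.Binary.Consequences using (tri⇒asym; tri⇒irr; tri⇒dec<)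
open import Relation.Binary.Construct.Closure.ReflexiveTransitive using (ε; _◅_)
open import Relation.Binary.Definitions using (Asymmetric; Decidable; tri<; tri≈; tri>)
open import Relation.Binary.PropositionalEquality.Core
  using (_≡_; _≢_; refl; sym; trans; cong; cong₂; subst)
open import Relation.Binary.PropositionalEquality.Properties using (module ≡-Reasoning)
open import Relation.Nullary.Decidable using (Dec; yes; no; does)
open import Relation.Nullary.Negation using (contradiction)

open import Algebra.Properties.Semiring.Sum ℕ.+-*-semiring
  using (sum; sum-syntax; sum-cong-≗; ∑-distrib-+)
open import Algebra.Properties.CommutativeSemigroup ℕ.+-commutativeSemigroup
  using (interchange; x∙yz≈y∙xz)
open import Algebra.Bundles using (module CommutativeRing)
import Algebra.Properties.Semiring.Sum (CommutativeRing.semiring ℚ.+-*-commutativeRing) as ℚ-Sum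

-- Finite sums

sum-mono-≤ : ∀ {k} {f g : Fin k → ℕ} → (∀ i → f i ℕ.≤ g i) → sum f ℕ.≤ sum g
sum-mono-≤ {zero}  f≤g = z≤n
sum-mono-≤ {suc k} f≤g = ℕ.+-mono-≤ (f≤g zero) (sum-mono-≤ (f≤g ∘ suc))

sum-const : ∀ k c → ∑[ i < k ] c ≡ k * c
sum-const zero    c = refl
sum-const (suc k) c = cong (_+_ c) (sum-const k c)

sum-↑ : ∀ k l (f : Fin (k + l) → ℕ) →
        sum f ≡ ∑[ i < k ] f (i ↑ˡ l) + ∑[ j < l ] f (k ↑ʳ j)
sum-↑ zero    l f = refl
sum-↑ (suc k) l f = trans (cong (_+_ (f zero)) (sum-↑ k l (f ∘ suc)))
                          (sym (ℕ.+-assoc (f zero) _ _))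

sum-combine : ∀ k l (f : Fin (k * l) → ℕ) →
              sum f ≡ ∑[ i < k ] ∑[ j < l ] f (combine i j)
sum-combine zero    l f = refl
sum-combine (suc k) l f =
  trans (sum-↑ l (k * l) f) (cong (_+_ _) (sum-combine k l (f ∘ (l ↑ʳ_))))

-- Averaging over the seed becomes averaging independently over a pivot index and the remaining
-- seed.
sum-remQuot : ∀ k l (f : Fin k × Fin l → ℕ) →
              ∑[ s < k * l ] f (remQuot l s) ≡ ∑[ i < k ] ∑[ j < l ] f (i , j)
sum-remQuot k l f = trans (sum-combine k l (f ∘ remQuot l))
  (sum-cong-≗ λ i → sum-cong-≗ λ j → cong f (remQuot-combine i j))

-- Trades pivot indices for candidates, so that induction on the list applies; `cast` bridges an
-- equality of sizes that is only propositional.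
sum-lookup : ∀ {A : Set} {k} (f : A → ℕ) (xs : List A) (eq : k ≡ List.length xs) →
             ∑[ i < k ] f (lookup xs (cast eq i)) ≡ ListAction.sum (List.map f xs)
sum-lookup {k = zero}  f []       eq = refl
sum-lookup {k = suc k} f (x ∷ xs) eq = cong (_+_ (f x)) (sum-lookup f xs (ℕ.suc-injective eq))

-- The algorithm

module _ {n : ℕ} where

  -- Continuation-passing style: a tree yields only a vertex, so the in-neighbours found reach the
  -- rest of the run as the argument of `k`. The pivot is dropped without a query.
  scan : Fin n → List (Fin n) → (List (Fin n) → DecisionTree n) → DecisionTree n
  scan w []       k = k []
  scan w (u ∷ us) k with u ≟ w
  ... | yes _  = scan w us k
  ... | no u≢w = query u w u≢w (scan w us (k ∘ (u ∷_))) (scan w us k)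

  mutual

    -- v is the latest pivot (arbitrary at the start) and xs, of length at most m,
    -- the list of candidates.
    find : ∀ m → Fin n → List (Fin n) → Fin (m !) → DecisionTree n
    find zero    v xs s = return v
    find (suc m) v xs s = findStep m v xs (List.length xs ℕ.≟ suc m) (remQuot (m !) s)

    -- The test and the decoded seed are arguments, so that proofs can split on the one and sum over
    -- the other.
    findStep : ∀ m → Fin n → (xs : List (Fin n)) → Dec (List.length xs ≡ suc m) →
               Fin (suc m) × Fin (m !) → DecisionTree n
    findStep m v xs (yes eq) (i , s) = let w = lookup xs (cast (sym eq) i) in
                                       scan w xs (λ ys → find m w ys s)
    findStep m v xs (no _)   (_ , s) = find m v xs s

-- In-neighbours and scans

module _ {n : ℕ} (T : Tournament n) where
  open Tournament T

  _⟶?_ : Decidable _⟶_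
  _⟶?_ = tri⇒dec< compare

  asym : Asymmetric _⟶_
  asym = tri⇒asym compare

  inNeighbours outNeighbours : Fin n → List (Fin n) → List (Fin n)
  inNeighbours  w = filter (_⟶? w)
  outNeighbours w = filter (w ⟶?_)

  inNeighbours-irrefl : ∀ w us → inNeighbours w (w ∷ us) ≡ inNeighbours w us
  inNeighbours-irrefl w us = filter-reject (_⟶? w) (tri⇒irr compare refl)

  output-scan : ∀ w us k → output T (scan w us k) ≡ output T (k (inNeighbours w us))
  output-scan w []       k = refl
  output-scan w (u ∷ us) k with u ≟ w
  ... | yes refl rewrite inNeighbours-irrefl w us = output-scan w us k
  ... | no u≢w with oracle T u w u≢w
  ...   | inj₁ u⟶w rewrite filter-accept (_⟶? w) {xs = us} u⟶w = output-scan w us _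
  ...   | inj₂ w⟶u rewrite filter-reject (_⟶? w) {xs = us} (asym w⟶u) = output-scan w us k

  -- Only an inequality, since an entry equal to `w` costs no query.
  queries-scan : ∀ w us k →
    queries T (scan w us k) ℕ.≤ List.length us + queries T (k (inNeighbours w us))
  queries-scan w []       k = ℕ.≤-refl
  queries-scan w (u ∷ us) k with u ≟ w
  ... | yes refl rewrite inNeighbours-irrefl w us = ℕ.m≤n⇒m≤1+n (queries-scan w us k)
  ... | no u≢w with oracle T u w u≢w
  ...   | inj₁ u⟶w rewrite filter-accept (_⟶? w) {xs = us} u⟶w = s≤s (queries-scan w us _)
  ...   | inj₂ w⟶u rewrite filter-reject (_⟶? w) {xs = us} (asym w⟶u) = s≤s (queries-scan w us k)

  length-inNeighbours : ∀ {w us} → w ∈ us → List.length (inNeighbours w us) ℕ.< List.length us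
  length-inNeighbours {w} {us} w∈us =
    filter-notAll (_⟶? w) us (lose w∈us (tri⇒irr compare refl))

  -- Correctness

  Reaches : Fin n → Fin n → Set
  Reaches v u = u ≢ v → ∃ λ (p : Path T v u) → length T p ℕ.≤ 2

  -- When `xs` is empty this makes `v` a king; when `xs` holds every vertex it is vacuous.
  -- Candidates are covered as well as `v` because the next pivot is one of them.
  Invariant : Fin n → List (Fin n) → Set
  Invariant v xs = ∀ {x u} → x ∈ v ∷ xs → u ∉ xs → Reaches x u

  -- A vertex outside `xs` is handled by the old invariant, as the new pivot and its in-neighbours
  -- lie in `xs`. A vertex discarded now is `w` or beaten by `w`, and every remaining candidate
  -- beats `w`, so two edges suffice.
  Invariant-inNeighbours : ∀ {v w xs} → w ∈ xs → Invariant v xs → Invariant w (inNeighbours w xs)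
  Invariant-inNeighbours {w = w} {xs} w∈xs inv {x} {u} x∈ u∉ with any? (u ≟_) xs
  ... | no u∉xs  = inv (there (x∈xs x∈)) u∉xs
    where
    x∈xs : x ∈ w ∷ inNeighbours w xs → x ∈ xs
    x∈xs (here refl) = w∈xs
    x∈xs (there x∈)  = proj₁ (∈-filter⁻ (_⟶? w) x∈)
  ... | yes u∈xs with compare u w
  ...   | tri< u⟶w _ _ = contradiction (∈-filter⁺ (_⟶? w) u∈xs u⟶w) u∉
  ...   | tri≈ _ refl _ = reaches-w x∈
    where
    reaches-w : x ∈ w ∷ inNeighbours w xs → Reaches x w
    reaches-w (here refl) w≢w = contradiction refl w≢w
    reaches-w (there x∈)  _   = proj₂ (∈-filter⁻ (_⟶? w) {xs = xs} x∈) ◅ ε , s≤s z≤n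
  ...   | tri> _ _ w⟶u = reaches-u x∈
    where
    reaches-u : x ∈ w ∷ inNeighbours w xs → Reaches x u
    reaches-u (here refl) _ = w⟶u ◅ ε , s≤s z≤n
    reaches-u (there x∈)  _ =
      proj₂ (∈-filter⁻ (_⟶? w) {xs = xs} x∈) ◅ w⟶u ◅ ε , s≤s (s≤s z≤n)

  mutual

    find-king : ∀ m v xs s → List.length xs ℕ.≤ m → Invariant v xs →
                King T (output T (find m v xs s))
    find-king zero    v [] s _     inv u = inv (here refl) λ ()
    find-king (suc m) v xs s |xs|≤ inv =
      findStep-king m v xs (List.length xs ℕ.≟ suc m) (remQuot (m !) s) |xs|≤ inv

    findStep-king : ∀ m v xs d is → List.length xs ℕ.≤ suc m → Invariant v xs →
                    King T (output T (findStep m v xs d is))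
    findStep-king m v xs (yes eq) (i , s) |xs|≤ inv =
      subst (King T) (sym (output-scan w xs _))
        (find-king m w _ s (s≤s⁻¹ (ℕ.≤-trans (length-inNeighbours w∈xs) |xs|≤))
                   (Invariant-inNeighbours w∈xs inv))
      where
      w = lookup xs (cast (sym eq) i)
      w∈xs = ∈-lookup {xs = xs} (cast (sym eq) i)
    findStep-king m v xs (no neq) (i , s) |xs|≤ inv =
      find-king m v xs s (s≤s⁻¹ (ℕ.≤∧≢⇒< |xs|≤ neq)) inv

  -- Expected number of queries

  inDegree outDegree : Fin n → List (Fin n) → ℕ
  inDegree  w us = List.length (inNeighbours w us)
  outDegree w us = List.length (outNeighbours w us)

  degrees≤length : ∀ w us → inDegree w us + outDegree w us ℕ.≤ List.length us
  degrees≤length w [] = z≤n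
  degrees≤length w (u ∷ us) with u ⟶? w | w ⟶? u
  ... | yes u⟶w | yes w⟶u = contradiction w⟶u (asym u⟶w)
  ... | yes _   | no _    = s≤s (degrees≤length w us)
  ... | no _    | yes _   rewrite ℕ.+-suc (inDegree w us) (outDegree w us) = s≤s (degrees≤length w us)
  ... | no _    | no _    = ℕ.m≤n⇒m≤1+n (degrees≤length w us)

  -- Counts the edges leading from `us` to `ws`, grouped by head.
  edges : List (Fin n) → List (Fin n) → ℕ
  edges us ws = ListAction.sum (List.map (λ w → inDegree w us) ws)

  -- Double counting: the edges with tail `u` are split off although the definition groups by head,
  -- which permits induction on the first list.
  edges-∷ : ∀ u us ws → edges (u ∷ us) ws ≡ outDegree u ws + edges us ws
  edges-∷ u us [] = refl
  edges-∷ u us (w ∷ ws) rewrite edges-∷ u us ws with does (u ⟶? w)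
  ... | true  = cong suc (x∙yz≈y∙xz (inDegree w us) (outDegree u ws) (edges us ws))
  ... | false = x∙yz≈y∙xz (inDegree w us) (outDegree u ws) (edges us ws)

  -- By asymmetry each pair carries at most one edge. Two separate lists allow induction on one
  -- alone; for `us` equal to `ws` the mean in-degree is at most half the length.
  edges-both-ways : ∀ us ws → edges us ws + edges ws us ℕ.≤ List.length us * List.length ws
  edges-both-ways [] ws rewrite ℕ.+-identityʳ (edges [] ws) = ℕ.≤-reflexive (edges-[] ws)
    where
    edges-[] : ∀ ws → edges [] ws ≡ 0
    edges-[] []       = refl
    edges-[] (_ ∷ ws) = edges-[] ws
  edges-both-ways (u ∷ us) ws = begin
    edges (u ∷ us) ws + (i + edges ws us)     ≡⟨ cong (_+ (i + edges ws us)) (edges-∷ u us ws) ⟩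
    (o + edges us ws) + (i + edges ws us)     ≡⟨ interchange o (edges us ws) i (edges ws us) ⟩
    (o + i) + (edges us ws + edges ws us)     ≡⟨ cong (_+ (edges us ws + edges ws us)) (ℕ.+-comm o i) ⟩
    (i + o) + (edges us ws + edges ws us)     ≤⟨ ℕ.+-mono-≤ (degrees≤length u ws) (edges-both-ways us ws) ⟩
    List.length ws + List.length us * List.length ws  ∎
    where
    open ℕ.≤-Reasoning
    i = inDegree u ws
    o = outDegree u ws

  mutual

    -- A bound on the mean over `m !` equally likely seeds, cleared of denominators so that the
    -- induction stays in `ℕ`.
    sum-queries-find : ∀ m v xs → List.length xs ℕ.≤ m →
      ∑[ s < m ! ] queries T (find m v xs s) ℕ.≤ m ! * (2 * List.length xs)
    sum-queries-find zero    v xs _     = z≤n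
    sum-queries-find (suc m) v xs |xs|≤ = begin
      ∑[ s < suc m * m ! ] queries T (findStep m v xs d (remQuot (m !) s))
        ≡⟨ sum-remQuot (suc m) (m !) (queries T ∘ findStep m v xs d) ⟩
      ∑[ i < suc m ] ∑[ s < m ! ] queries T (findStep m v xs d (i , s))
        ≤⟨ sum-queries-findStep m v xs d |xs|≤ ⟩
      suc m * m ! * (2 * List.length xs) ∎
      where
      open ℕ.≤-Reasoning
      d = List.length xs ℕ.≟ suc m

    sum-queries-findStep : ∀ m v xs d → List.length xs ℕ.≤ suc m →
      ∑[ i < suc m ] ∑[ s < m ! ] queries T (findStep m v xs d (i , s))
        ℕ.≤ suc m * m ! * (2 * List.length xs)
    sum-queries-findStep m v xs (no neq) |xs|≤ = begin
      ∑[ i < suc m ] ∑[ s < m ! ] queries T (find m v xs s)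
        -- All values of `i` lead to the same run.
        ≡⟨ sum-const (suc m) _ ⟩
      suc m * ∑[ s < m ! ] queries T (find m v xs s)
        ≤⟨ ℕ.*-monoʳ-≤ (suc m) (sum-queries-find m v xs (s≤s⁻¹ (ℕ.≤∧≢⇒< |xs|≤ neq))) ⟩
      suc m * (m ! * (2 * List.length xs))
        ≡⟨ ℕ.*-assoc (suc m) (m !) _ ⟨
      suc m * m ! * (2 * List.length xs) ∎
      where open ℕ.≤-Reasoning
    sum-queries-findStep m v xs (yes eq) |xs|≤ = begin
      ∑[ i < suc m ] ∑[ s < m ! ] queries T (scan (w i) xs (λ ys → find m (w i) ys s))
        ≤⟨ sum-mono-≤ pivot-cost ⟩
      ∑[ i < suc m ] (m ! * (l + 2 * inDegree (w i) xs))
        ≡⟨ sum-lookup (λ w → m ! * (l + 2 * inDegree w xs)) xs (sym eq) ⟩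
      ListAction.sum (List.map (λ w → m ! * (l + 2 * inDegree w xs)) xs)
        ≡⟨ sum-affine xs ⟩
      m ! * (l * l + (edges xs xs + edges xs xs))
        -- The factor 2 of the inductive bound cancels the halving of the candidates: up to the
        -- factor `m !`, scans and recursion contribute at most `l * l` each over the `l` pivots.
        ≤⟨ ℕ.*-monoʳ-≤ (m !) (ℕ.+-monoʳ-≤ (l * l) (edges-both-ways xs xs)) ⟩
      m ! * (l * l + l * l)
        ≡⟨ solve 2 (λ f l → f :* (l :* l :+ l :* l) := l :* f :* (con 2 :* l)) refl (m !) l ⟩
      l * m ! * (2 * l)
        ≡⟨ cong (λ k → k * m ! * (2 * l)) eq ⟩
      suc m * m ! * (2 * l) ∎
      where
      open ℕ.≤-Reasoning
      open +-*-Solver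
      l = List.length xs

      w : Fin (suc m) → Fin n
      w i = lookup xs (cast (sym eq) i)

      pivot-cost : ∀ i → ∑[ s < m ! ] queries T (scan (w i) xs (λ ys → find m (w i) ys s))
                         ℕ.≤ m ! * (l + 2 * inDegree (w i) xs)
      pivot-cost i = begin
        ∑[ s < m ! ] queries T (scan (w i) xs (λ ys → find m (w i) ys s))
          ≤⟨ sum-mono-≤ (λ s → queries-scan (w i) xs (λ ys → find m (w i) ys s)) ⟩
        ∑[ s < m ! ] (l + queries T (find m (w i) ys s))
          ≡⟨ ∑-distrib-+ (λ _ → l) (λ s → queries T (find m (w i) ys s)) ⟩
        ∑[ s < m ! ] l + ∑[ s < m ! ] queries T (find m (w i) ys s)
          ≤⟨ ℕ.+-mono-≤ (ℕ.≤-reflexive (sum-const (m !) l)) (sum-queries-find m (w i) ys |ys|≤m) ⟩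
        m ! * l + m ! * (2 * inDegree (w i) xs)
          ≡⟨ ℕ.*-distribˡ-+ (m !) l _ ⟨
        m ! * (l + 2 * inDegree (w i) xs) ∎
        where
        ys = inNeighbours (w i) xs
        |ys|≤m = s≤s⁻¹ (ℕ.≤-trans (length-inNeighbours (∈-lookup {xs = xs} (cast (sym eq) i))) |xs|≤)

      sum-affine : ∀ ws → ListAction.sum (List.map (λ w → m ! * (l + 2 * inDegree w xs)) ws)
                          ≡ m ! * (List.length ws * l + (edges xs ws + edges xs ws))
      sum-affine []       = sym (ℕ.*-zeroʳ (m !))
      sum-affine (w ∷ ws) rewrite sum-affine ws =
        solve 5 (λ f l d k e → f :* (l :+ con 2 :* d) :+ f :* (k :* l :+ (e :+ e))
                              := f :* ((l :+ k :* l) :+ ((d :+ e) :+ (d :+ e))))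
              refl (m !) l (inDegree w xs) (List.length ws) (edges xs ws)

-- Uniform distributions

ι : ℕ → ℚ
ι k = + k / 1

-- `_/_` normalises by a gcd, which does not compute on a variable; `fromℤ` is already a reduced
-- fraction, so arithmetic on it unfolds.
ι≡fromℤ : ∀ k → ι k ≡ fromℤ (+ k)
ι≡fromℤ k = ℚ.↥p/↧p≡p (fromℤ (+ k))

ι-+ : ∀ a b → ι (a + b) ≡ ι a ℚ.+ ι b
ι-+ a b rewrite ι≡fromℤ a | ι≡fromℤ b =
  cong (_/ 1) (sym (cong₂ ℤ._+_ (ℤ.*-identityʳ (+ a)) (ℤ.*-identityʳ (+ b))))

ι-* : ∀ a b → ι (a * b) ≡ ι a ℚ.* ι b
ι-* a b rewrite ι≡fromℤ a | ι≡fromℤ b = cong (_/ 1) (ℤ.pos-* a b)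

ι-mono-≤ : ∀ {a b} → a ℕ.≤ b → ι a ≤ ι b
ι-mono-≤ {a} {b} a≤b rewrite ι≡fromℤ a | ι≡fromℤ b =
  *≤* (ℤ.*-monoʳ-≤-nonNeg (+ 1) (ℤ.+≤+ a≤b))

ι-sum : ∀ {k} (f : Fin k → ℕ) → ℚ-Sum.sum (ι ∘ f) ≡ ι (sum f)
ι-sum {zero}  f = refl
ι-sum {suc k} f = trans (cong (ι (f zero) ℚ.+_) (ι-sum (f ∘ suc))) (sym (ι-+ (f zero) _))

module _ (k : ℕ) .{{_ : NonZero k}} where

  private
    instance
      ι-positive : ℚ.Positive (ι k)
      ι-positive = ℚ.normalize-pos k 1

      ι-nonZero : ℚ.NonZero (ι k)
      ι-nonZero = ℚ.pos⇒nonZero (ι k)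

  1/ι : ℚ
  1/ι = 1/ ι k

  1/ι-positive : ℚ.Positive 1/ι
  1/ι-positive = ℚ.1/pos⇒pos (ι k)

  mean : (f : Fin k → ℕ) → ℚ-Sum.sum (λ i → 1/ι ℚ.* ι (f i)) ≡ 1/ι ℚ.* ι (sum f)
  mean f = trans (sym (ℚ-Sum.*-distribˡ-sum 1/ι (ι ∘ f))) (cong (1/ι ℚ.*_) (ι-sum f))

  1/ι-*-ι : ∀ c → 1/ι ℚ.* ι (k * c) ≡ ι c
  1/ι-*-ι c = begin
    1/ι ℚ.* ι (k * c)       ≡⟨ cong (1/ι ℚ.*_) (ι-* k c) ⟩
    1/ι ℚ.* (ι k ℚ.* ι c)   ≡⟨ ℚ.*-assoc 1/ι (ι k) (ι c) ⟨
    1/ι ℚ.* ι k ℚ.* ι c     ≡⟨ cong (ℚ._* ι c) (ℚ.*-inverseˡ (ι k)) ⟩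
    1ℚ ℚ.* ι c              ≡⟨ ℚ.*-identityˡ (ι c) ⟩
    ι c                     ∎
    where open ≡-Reasoning

  -- Carries a count over seeds in `ℕ` over to an expectation in `ℚ`.
  mean-≤ : (f : Fin k → ℕ) (c : ℕ) → sum f ℕ.≤ k * c →
           ℚ-Sum.sum (λ i → 1/ι ℚ.* ι (f i)) ≤ ι c
  mean-≤ f c Σf≤kc = begin
    ℚ-Sum.sum (λ i → 1/ι ℚ.* ι (f i))  ≡⟨ mean f ⟩
    1/ι ℚ.* ι (sum f)                   ≤⟨ ℚ.*-monoˡ-≤-nonNeg 1/ι (ι-mono-≤ Σf≤kc) ⟩
    1/ι ℚ.* ι (k * c)                   ≡⟨ 1/ι-*-ι c ⟩
    ι c                                 ∎
    where
    open ℚ.≤-Reasoning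
    instance
      1/ι-nonNegative : ℚ.NonNegative 1/ι
      1/ι-nonNegative = ℚ.pos⇒nonNeg 1/ι {{1/ι-positive}}

  sum-1/ι : ℚ-Sum.sum {k} (λ _ → 1/ι) ≡ 1ℚ
  sum-1/ι = begin
    -- The total weight is the mean of the constant 1.
    ℚ-Sum.sum {k} (λ _ → 1/ι)            ≡⟨ ℚ-Sum.sum-cong-≗ {k} (λ _ → sym (ℚ.*-identityʳ 1/ι)) ⟩
    ℚ-Sum.sum {k} (λ _ → 1/ι ℚ.* ι 1)   ≡⟨ mean (λ _ → 1) ⟩
    1/ι ℚ.* ι (∑[ i < k ] 1)             ≡⟨ cong (λ l → 1/ι ℚ.* ι l) (sum-const k 1) ⟩
    1/ι ℚ.* ι (k * 1)                    ≡⟨ 1/ι-*-ι 1 ⟩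
    1ℚ                                   ∎
    where open ≡-Reasoning

  uniform : ∀ {n} → (Fin k → DecisionTree n) → RandomizedAlgorithm n
  uniform tree = record
    { size     = k
    ; tree     = tree
    ; weight   = λ _ → 1/ι
    ; positive = λ _ → ℚ.positive⁻¹ 1/ι {{1/ι-positive}}
    ; total    = sum-1/ι
    }

-- The algorithm started on all vertices

theorem1p2 : Σ[ R ∈ (∀ n → .{{_ : NonZero n}} → RandomizedAlgorithm n) ]
    (∀ n → .{{_ : NonZero n}} → (T : Tournament n) →
    AlwaysOutputsKing (R n) T × expectedQueries (R n) T ≤ (+ (2 * n)) / 1)
theorem1p2 = R , λ { n@(suc _) T → king n T , cost n T }
  where
  R : ∀ n → .{{_ : NonZero n}} → RandomizedAlgorithm n
  -- Matching on `suc` provides the vertex `zero` as the arbitrary initial pivot.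
  R n@(suc _) = uniform (n !) {{n ℕ.!≢0}} (find n zero (allFin n))

  length-allFin : ∀ n → List.length (allFin n) ≡ n
  length-allFin n = length-tabulate {n = n} (λ i → i)

  king : ∀ n .{{_ : NonZero n}} T → AlwaysOutputsKing (R n) T
  king n@(suc _) T s = find-king T n zero (allFin n) s (ℕ.≤-reflexive (length-allFin n))
                         -- Nothing is discarded at the start, so the invariant is vacuous.
                         λ {_} {u} _ u∉ → contradiction (∈-allFin u) u∉

  cost : ∀ n .{{_ : NonZero n}} T → expectedQueries (R n) T ≤ ι (2 * n)
  cost n@(suc _) T = mean-≤ (n !) {{n ℕ.!≢0}} f (2 * n)
    (subst (λ l → sum f ℕ.≤ n ! * (2 * l)) (length-allFin n)
      (sum-queries-find T n zero (allFin n) (ℕ.≤-reflexive (length-allFin n))))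
    where
    f : Fin (n !) → ℕ
    f s = queries T (find n zero (allFin n) s)
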